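{- For every integer $k\ge 1$ there is a polynomial $D_k$ of degree exactly $2k-2$ such that $d_k(n)=D_k(n)$ for all integers $n\ge 1$; and for every integer $k\ge 2$ there is a polynomial $S_k$ of degree exactly $2k-3$ such that $s_k(n)=S_k(n)$ for all integers $n\ge 1$.
   Context: For $n\ge 1$, the $2\times n$ board consists of $2n$ unit squares arranged in 2 rows and $n$ columns; two squares are adjacent iff they share an edge. A piece is a nonempty set of squares that is connected under adjacency. A division of the board into $k$ pieces is a partition of the set of all $2n$ squares into exactly $k$ pieces. $d_k(n)$ denotes the number of divisions of the $2\times n$ board into $k$ pieces. $s_k(n)$ denotes the number of such divisions in which the two squares of the rightmost column lie in different pieces. -}

module Defs where

open import Data.Fin.Base using (Fin; zero; suc; toℕ; fromℕ)
open import Data.Integer.Base using (+_)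
open import Data.List.Base using (List; []; _∷_)
open import Data.Nat.Base using (ℕ; zero; suc; _<_; NonZero)
open import Data.Product using (Σ; ∃-syntax; ∃₂; ∃!; _×_; _,_; proj₁)
open import Data.Rational.Base using (ℚ; 0ℚ; _+_; _*_; _/_)
open import Data.Sum.Base using (_⊎_)
open import Function.Bundles using (Bijection)
open import Level using (0ℓ; _⊔_) renaming (suc to lsuc)
open import Relation.Binary.Bundles using (Setoid)
import Relation.Binary.Construct.On as On
open import Relation.Binary.Construct.Closure.ReflexiveTransitive using (Star)
open import Relation.Binary.PropositionalEquality using (_≡_; _≢_)
import Relation.Binary.PropositionalEquality.Properties as ≡
open import Relation.Unary using (Pred; _∈_; _≐_; Satisfiable)
open import Relation.Unary.Properties using (≐-refl; ≐-trans)

Square : ℕ → Set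
Square n = Fin 2 × Fin n

Consecutive : ∀ {m} → Fin m → Fin m → Set
Consecutive i j = toℕ j ≡ suc (toℕ i) ⊎ toℕ i ≡ suc (toℕ j)

Adjacent : ∀ {n} → Square n → Square n → Set
Adjacent (r , c) (r′ , c′) = (r ≡ r′ × Consecutive c c′) ⊎ (Consecutive r r′ × c ≡ c′)

Connected : ∀ {n} → Pred (Square n) 0ℓ → Set
Connected P = ∀ {x y} → x ∈ P → y ∈ P →
              Star (λ u v → u ∈ P × v ∈ P × Adjacent u v) x y

record Piece (n : ℕ) : Set₁ where
  field
    squares   : Pred (Square n) 0ℓ
    nonempty  : Satisfiable squares
    connected : Connected squares

open Piece public

-- A partition into exactly k pieces, presented with an arbitrary numbering of
-- the pieces.  The numbering is forgotten by _≈ᴰ_ below; since the pieces are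
-- nonempty and disjoint, differently numbered pieces are different sets.

record Division (k n : ℕ) : Set₁ where
  field
    piece     : Fin k → Piece n
    partition : ∀ x → ∃! _≡_ (λ i → x ∈ squares (piece i))

open Division public

_≈ᴰ_ : ∀ {k n} → Division k n → Division k n → Set
D ≈ᴰ E = (∀ i → ∃[ j ] squares (piece D i) ≐ squares (piece E j))
       × (∀ j → ∃[ i ] squares (piece E j) ≐ squares (piece D i))

divisions : ℕ → ℕ → Setoid (lsuc 0ℓ) 0ℓ
divisions k n = record
  { Carrier       = Division k n
  ; _≈_           = _≈ᴰ_
  ; isEquivalence = record
    { refl  = (λ i → i , ≐-refl) , (λ i → i , ≐-refl)
    ; sym   = λ (f , g) → g , f
    ; trans = λ (f , f⁻) (g , g⁻) → compose f g , compose g⁻ f⁻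
    }
  }
  where
  compose : ∀ {I J K : Set} {P : I → Pred (Square n) 0ℓ}
            {Q : J → Pred (Square n) 0ℓ} {R : K → Pred (Square n) 0ℓ} →
            (∀ i → ∃[ j ] P i ≐ Q j) → (∀ j → ∃[ l ] Q j ≐ R l) →
            ∀ i → ∃[ l ] P i ≐ R l
  compose f g i with f i
  ... | j , P≐Q with g j
  ...   | l , Q≐R = l , ≐-trans P≐Q Q≐R

rightmost : ∀ n → .{{NonZero n}} → Fin n
rightmost (suc n) = fromℕ n

SplitsRightmost : ∀ {k n} → .{{NonZero n}} → Division k n → Set
SplitsRightmost {n = n} D = ∃₂ λ i j →
  i ≢ j × (zero , rightmost n) ∈ squares (piece D i)
        × (suc zero , rightmost n) ∈ squares (piece D j)

splitDivisions : ∀ k n → .{{NonZero n}} → Setoid (lsuc 0ℓ) 0ℓ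
splitDivisions k n = On.setoid {B = Σ (Division k n) SplitsRightmost} (divisions k n) proj₁

HasCardinality : ∀ {a ℓ} → Setoid a ℓ → ℕ → Set (a ⊔ ℓ)
HasCardinality S m = Bijection S (≡.setoid (Fin m))

-- The counts d_k(n) and s_k(n) as relations: m is the number of divisions, resp.
-- the number of those whose rightmost column is split.

d[_,_]≔_ : ℕ → ℕ → ℕ → Set₁
d[ k , n ]≔ m = HasCardinality (divisions k n) m

s[_,_]≔_ : ∀ (k n : ℕ) → .{{NonZero n}} → ℕ → Set₁
s[ k , n ]≔ m = HasCardinality (splitDivisions k n) m

-- Polynomials over ℚ as coefficient lists, constant term first; trailing
-- zeros are allowed.

Poly : Set
Poly = List ℚ

coeff : Poly → ℕ → ℚ
coeff []      _       = 0ℚ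
coeff (a ∷ p) zero    = a
coeff (a ∷ p) (suc i) = coeff p i

HasDegree : Poly → ℕ → Set
HasDegree p d = coeff p d ≢ 0ℚ × (∀ i → d < i → coeff p i ≡ 0ℚ)

eval : Poly → ℚ → ℚ
eval []      x = 0ℚ
eval (a ∷ p) x = a + x * eval p x

fromNat : ℕ → ℚ
fromNat n = + n / 1

{-# OPTIONS --safe #-}
module Submission where

-- A division is determined by which adjacent squares share a piece, since pieces are connected.
-- The patterns that arise are those in which no 2×2 block has exactly three of its four edges
-- inside a piece, and the number of pieces is then a sum of local contributions.  Adding a
-- column to the patterns whose outer column is joined (T) or split (S) increases their number by
--   ΔT_k = 2 S_k + T_{k-1} + S_{k-1},
--   ΔS_k = 2 T_{k-1} + 2 S_{k-1} + T_{k-2} + S_{k-2}.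
-- This operator is nonnegative and locally nilpotent in k, so the iterated differences at n = 1
-- are the coefficients of Newton's expansion in the binomials C(n-1,i); tracking which of them
-- vanish gives the degrees.  Columns are added on the left, so the split condition on the
-- rightmost column only changes the initial values.

open import Defs
open import Data.Bool.Base using (Bool; true; false; not; _∧_; T; if_then_else_)
open import Data.Bool.Properties using (∧-zeroʳ; T-irrelevant; T-∧)
open import Data.Empty using (⊥-elim)
open import Data.Fin.Base using (Fin; zero; suc; toℕ; fromℕ; _↑ʳ_)
open import Data.Fin.Properties using (_≟_; +↔⊎; ↑ʳ-injective; injective⇒≤)
import Data.Integer.Base as ℤ
import Data.Integer.Properties as ℤ
open import Data.List.Base using ([]; _∷_)
open import Data.Nat.Base
  using (ℕ; zero; suc; _+_; _*_; _∸_; _≤_; _<_; _≡ᵇ_; z≤n; s≤s; s≤s⁻¹; z<s; NonZero)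
open import Data.Nat.Combinatorics using (_C_; nCk+nC[k+1]≡[n+1]C[k+1]; k>n⇒nCk≡0; nC1≡n)
open import Data.Nat.Properties
  using ( ≤-refl; ≤-reflexive; ≤-trans; ≤-antisym; n≤1+n; m≤m+n; m≤n+m; m<n⇒m<1+n
        ; +-suc; +-comm; +-assoc; +-identityʳ; +-monoˡ-≤
        ; *-comm; *-zeroʳ; *-identityˡ; *-identityʳ; *-distribˡ-+; suc-injective; ≡ᵇ⇒≡; ≡⇒≡ᵇ)
open import Data.Nat.Solver using (module +-*-Solver)
open import Data.Product using (Σ; ∃-syntax; _×_; _,_; proj₁; proj₂; map; map₂)
import Data.Rational.Base as ℚ
open ℚ using (ℚ; 0ℚ; 1ℚ; toℚᵘ)
import Data.Rational.Properties as ℚ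
import Data.Rational.Solver as ℚ
import Data.Rational.Unnormalised.Base as ℚᵘ
import Data.Rational.Unnormalised.Properties as ℚᵘ
open import Data.Sum.Base as Sum using (_⊎_; inj₁; inj₂)
open import Data.Sum.Function.Propositional using (_⊎-↔_)
open import Data.Unit.Base using (tt)
open import Data.Vec.Base using (Vec; []; _∷_)
open import Data.Vec.Properties using (∷-injective)
open import Function.Base using (_∘_; const; id)
open import Function.Bundles
  using (Equivalence; Injection; Inverse; _↔_; _⇔_; mk↔ₛ′; mk⇔)
open import Function.Construct.Composition using (_↔-∘_)
open import Function.Construct.Identity using (⇔-id)
open import Function.Construct.Symmetry using (↔-sym)
open import Function.Properties.Inverse using (Inverse⇒Injection)
open import Relation.Binary.Bundles using (Setoid)
open import Relation.Binary.Construct.Closure.ReflexiveTransitive as Star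
  using (Star; ε; _◅_; _◅◅_)
open import Relation.Binary.PropositionalEquality
  using (_≡_; _≢_; refl; sym; trans; cong; cong₂; subst; module ≡-Reasoning)
open import Relation.Nullary using (Dec; yes; no; does)
open import Relation.Nullary.Decidable using (dec-true; dec-false; does-⇔)
open import Relation.Unary using (_≐_)

-- Codes and their number

-- A division is encoded by the Booleans "these two adjacent squares share a piece": first the
-- one of the leftmost column, then for each further column the triple of that column and of
-- the top and bottom edges joining it to its left neighbour.
Tail : ℕ → Set
Tail = Vec (Bool × Bool × Bool)

base : Bool → ℕ
base true  = 1
base false = 2

-- How many pieces a new leftmost column adds.
weight : Bool → Bool → Bool → ℕ
weight true  true  _     = 0
weight true  false true  = 0
weight true  false false = 1
weight false true  true  = 0
weight false true  false = 1
weight false false true  = 1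
weight false false false = 2

pieces : ∀ {m} → Bool → Tail m → ℕ
pieces v []                 = base v
pieces v ((v′ , s , t) ∷ c) = weight v s t + pieces v′ c

-- Among the four edges of a 2×2 block, exactly three equalities are impossible.
closed : Bool → Bool → Bool → Bool → Bool
closed true  true  true  t     = t
closed true  false true  t     = not t
closed true  v′    false t     = not (v′ ∧ t)
closed false v′    s     t     = not (v′ ∧ s ∧ t)

valid : ∀ {m} → Bool → Tail m → Bool
valid v []                 = true
valid v ((v′ , s , t) ∷ c) = closed v v′ s t ∧ valid v′ c

last : ∀ {m} → Bool → Tail m → Bool
last v []                 = v
last v ((v′ , _ , _) ∷ c) = last v′ c

good : (Bool → Bool) → ∀ {m} → ℕ → Bool → Tail m → Bool
good q k v c = valid v c ∧ q (last v c) ∧ (pieces v c ≡ᵇ k)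

∑ᵇ : (Bool → ℕ) → ℕ
∑ᵇ f = f true + f false

∑³ : (Bool → Bool → Bool → ℕ) → ℕ
∑³ f = ∑ᵇ λ v → ∑ᵇ λ s → ∑ᵇ λ t → f v s t

# : ∀ {m} → (Tail m → Bool) → ℕ
# {zero}  P = if P [] then 1 else 0
# {suc m} P = ∑³ λ v s t → # λ c → P ((v , s , t) ∷ c)

∑³-cong : ∀ (f g : Bool → Bool → Bool → ℕ) → (∀ v s t → f v s t ≡ g v s t) → ∑³ f ≡ ∑³ g
∑³-cong f g f≡g =
  ∑ᵇ-cong λ v → ∑ᵇ-cong {λ s → ∑ᵇ (f v s)} λ s → ∑ᵇ-cong {f v s} (f≡g v s)
  where
  ∑ᵇ-cong : ∀ {f g} → (∀ b → f b ≡ g b) → ∑ᵇ f ≡ ∑ᵇ g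
  ∑ᵇ-cong f≡g = cong₂ _+_ (f≡g true) (f≡g false)

∑ᵇ-↔ : ∀ {B : Bool → Set} {f} → (∀ b → B b ↔ Fin (f b)) → Σ Bool B ↔ Fin (∑ᵇ f)
∑ᵇ-↔ {B} {f} B↔ = (↔-sym +↔⊎) ↔-∘ ((B↔ true ⊎-↔ B↔ false) ↔-∘ split)
  where
  split : Σ Bool B ↔ (B true ⊎ B false)
  split = mk↔ₛ′ (λ { (true , b) → inj₁ b ; (false , b) → inj₂ b })
                (λ { (inj₁ b) → true , b ; (inj₂ b) → false , b })
                (λ { (inj₁ _) → refl ; (inj₂ _) → refl })
                (λ { (true , _) → refl ; (false , _) → refl })

#-↔ : ∀ {m} (P : Tail m → Bool) → Σ (Tail m) (λ c → T (P c)) ↔ Fin (# P)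
#-↔ {zero}  P with P [] in eq
... | true  = mk↔ₛ′ (λ _ → zero) (λ _ → [] , subst T (sym eq) tt) (λ { zero → refl })
                    (λ { ([] , p) → cong ([] ,_) (T-irrelevant _ p) })
... | false = mk↔ₛ′ (λ { ([] , p) → ⊥-elim (subst T eq p) }) (λ ()) (λ ())
                    (λ { ([] , p) → ⊥-elim (subst T eq p) })
#-↔ {suc m} P =
  ∑ᵇ-↔ (λ v → ∑ᵇ-↔ λ s → ∑ᵇ-↔ λ t → #-↔ λ c → P ((v , s , t) ∷ c)) ↔-∘ uncons
  where
  uncons : Σ (Tail (suc m)) (λ c → T (P c)) ↔
           (Σ Bool λ v → Σ Bool λ s → Σ Bool λ t → Σ (Tail m) λ c → T (P ((v , s , t) ∷ c)))
  uncons = mk↔ₛ′ (λ { ((v , s , t) ∷ c , p) → v , s , t , c , p })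
                 (λ { (v , s , t , c , p) → (v , s , t) ∷ c , p })
                 (λ _ → refl) (λ { (_ ∷ _ , _) → refl })

#-cong : ∀ {m} {P Q : Tail m → Bool} → (∀ c → P c ≡ Q c) → # P ≡ # Q
#-cong {zero}  P≡Q = cong (if_then 1 else 0) (P≡Q [])
#-cong {suc m} P≡Q =
  ∑³-cong _ _ λ v s t → #-cong λ c → P≡Q ((v , s , t) ∷ c)

#-false : ∀ m → # {m} (λ _ → false) ≡ 0
#-false zero    = refl
#-false (suc m) rewrite #-false m = refl

-- Multiplication by x^w of a generating function in the number of pieces, `z` being the coefficient
-- below degree w. It is polymorphic because it acts on predicates (with `z` = `false`) and on
-- counts (with `z` = 0).
shift : ∀ {A : Set} → A → ℕ → (ℕ → A) → ℕ → A
shift z zero    f k       = f k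
shift z (suc w) f zero    = z
shift z (suc w) f (suc k) = shift z w f k

#-shift : ∀ {m} (P : ℕ → Tail m → Bool) w k →
          # (λ c → shift false w (λ j → P j c) k) ≡ shift 0 w (λ j → # (P j)) k
#-shift     P zero    k       = refl
#-shift {m} P (suc w) zero    = #-false m
#-shift     P (suc w) (suc k) = #-shift P w k

good-shift : ∀ q {m} w k v (c : Tail m) →
             valid v c ∧ q (last v c) ∧ (w + pieces v c ≡ᵇ k) ≡
             shift false w (λ j → good q j v c) k
good-shift q zero    k       v c = refl
good-shift q (suc w) zero    v c =
  trans (cong (valid v c ∧_) (∧-zeroʳ (q (last v c)))) (∧-zeroʳ (valid v c))
good-shift q (suc w) (suc k) v c = good-shift q w k v c

-- The bit `v` belongs to the leftmost column, where further columns are attached, while `q` tests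
-- the bit of the rightmost one; so the recurrence in m is the same for every `q`.
count : (Bool → Bool) → ℕ → Bool → ℕ → ℕ
count q m v k = # {m} (good q k v)

-- The transfer matrix minus the identity: the operator Δ above.
growth : (Bool → ℕ → ℕ) → Bool → ℕ → ℕ
growth f true  k = 2 * f false k + shift 0 1 (f true) k + shift 0 1 (f false) k
growth f false k = 2 * shift 0 1 (f true) k + 2 * shift 0 1 (f false) k
                 + shift 0 2 (f true) k + shift 0 2 (f false) k

-- Sorting by the eight triples `(v′ , s , t)`: those violating `closed` contribute nothing, the
-- others contribute the counts for `v′` shifted by their weight.
count-suc : ∀ q m v k → count q (suc m) v k ≡ count q m v k + growth (count q m) v k
count-suc q m v k = trans (expand v) (collect v)
  where
  term : Bool → Bool → Bool → Bool → ℕ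
  term v v′ s t = if closed v v′ s t then shift 0 (weight v s t) (count q m v′) k else 0

  restrict : ∀ v v′ s t → # {m} (λ c → good q k v ((v′ , s , t) ∷ c)) ≡ term v v′ s t
  restrict v v′ s t with closed v v′ s t
  ... | true  = trans (#-cong {m} (good-shift q (weight v s t) k v′))
                      (#-shift {m} (λ j → good q j v′) (weight v s t) k)
  ... | false = #-false m

  expand : ∀ v → count q (suc m) v k ≡ ∑³ (term v)
  expand v = ∑³-cong (λ v′ s t → # {m} λ c → good q k v ((v′ , s , t) ∷ c)) (term v) (restrict v)

  -- The identity part is the triple with `v′` equal to `v` and both horizontal edges joined; the
  -- remaining triples add up to `growth`.
  collect : ∀ v → ∑³ (term v) ≡
                  count q m v k + growth (count q m) v k
  collect true  = solve 4 (λ a b c d →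
      ((a :+ con 0) :+ (con 0 :+ c)) :+ ((con 0 :+ b) :+ (b :+ d)) :=
      a :+ (con 2 :* b :+ c :+ d)) refl
      (count q m true k) (count q m false k)
      (shift 0 1 (count q m true) k) (shift 0 1 (count q m false) k)
    where open +-*-Solver
  collect false = solve 6 (λ a b c d e f →
      ((con 0 :+ c) :+ (c :+ e)) :+ ((b :+ d) :+ (d :+ f)) :=
      b :+ (con 2 :* c :+ con 2 :* d :+ e :+ f)) refl
      (count q m true k) (count q m false k)
      (shift 0 1 (count q m true) k) (shift 0 1 (count q m false) k)
      (shift 0 2 (count q m true) k) (shift 0 2 (count q m false) k)
    where open +-*-Solver

-- Divisions and their codes

Linked : ∀ {n k} → (Square n → Fin k) → Square n → Square n → Set
Linked f = Star (λ u v → f u ≡ f v × Adjacent u v)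

-- A division presented as a labelling with nonempty connected fibres. Equality of labels is
-- decidable, so the bits of a code can be computed.
record IsPartition {n k} (f : Square n → Fin k) : Set where
  field
    onto   : ∀ i → ∃[ x ] f x ≡ i
    linked : ∀ {x y} → f x ≡ f y → Linked f x y

open IsPartition

Adjacent-sym : ∀ {n} {x y : Square n} → Adjacent x y → Adjacent y x
Adjacent-sym = Sum.map (λ (e , c) → sym e , Sum.swap c) (λ (c , e) → Sum.swap c , sym e)

Linked-sym : ∀ {n k} {f : Square n → Fin k} {x y} → Linked f x y → Linked f y x
Linked-sym = Star.reverse (λ (e , adj) → sym e , Adjacent-sym adj)

Linked⇒≡ : ∀ {n k} {f : Square n → Fin k} {x y} → Linked f x y → f x ≡ f y
Linked⇒≡ ε            = refl
Linked⇒≡ ((e , _) ◅ p) = trans e (Linked⇒≡ p)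

next : ∀ {n} → Square n → Square (suc n)
next (r , c) = r , suc c

Adjacent-next : ∀ {n} {x y : Square n} → Adjacent x y → Adjacent (next x) (next y)
Adjacent-next = Sum.map (map₂ (Sum.map (cong suc) (cong suc))) (map₂ (cong suc))

vertical : ∀ {m k} → (Square (suc m) → Fin k) → Bool
vertical f = does (f (zero , zero) ≟ f (suc zero , zero))

tailCode : ∀ {m k} → (Square (suc m) → Fin k) → Tail m
tailCode {zero}  f = []
tailCode {suc m} f =
  (vertical (f ∘ next) ,
   does (f (zero , zero) ≟ f (zero , suc zero)) ,
   does (f (suc zero , zero) ≟ f (suc zero , suc zero))) ∷ tailCode (f ∘ next)

-- The numbering of the pieces is forgotten by keeping only which squares share a label.
SameKernel : ∀ {n k l} → (Square n → Fin k) → (Square n → Fin l) → Set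
SameKernel f g = ∀ x y → f x ≡ f y ⇔ g x ≡ g y

vertical-cong : ∀ {m k l} {f : Square (suc m) → Fin k} {g : Square (suc m) → Fin l} →
                SameKernel f g → vertical f ≡ vertical g
vertical-cong f∼g = does-⇔ (f∼g _ _) (_ ≟ _) (_ ≟ _)

tailCode-cong : ∀ {m k l} {f : Square (suc m) → Fin k} {g : Square (suc m) → Fin l} →
                SameKernel f g → tailCode f ≡ tailCode g
tailCode-cong {zero}          f∼g = refl
tailCode-cong {suc m} {f = f} {g} f∼g = cong₂ _∷_
  (cong₂ _,_ (vertical-cong {f = f ∘ next} {g ∘ next} λ x y → f∼g (next x) (next y))
    (cong₂ _,_ (does-⇔ (f∼g _ _) (_ ≟ _) (_ ≟ _)) (does-⇔ (f∼g _ _) (_ ≟ _) (_ ≟ _))))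
  (tailCode-cong λ x y → f∼g (next x) (next y))

does-transfer : ∀ {A B : Set} (A? : Dec A) (B? : Dec B) → does A? ≡ does B? → A → B
does-transfer (yes _) (yes b) _  _ = b
does-transfer (yes _) (no _)  () _
does-transfer (no ¬a) _       _  a = ⊥-elim (¬a a)

-- A code determines the partition.

module _ {k l : ℕ} where

  vertical-transfer : ∀ {m} (f : Square (suc m) → Fin k) (g : Square (suc m) → Fin l) →
    vertical f ≡ vertical g → tailCode f ≡ tailCode g →
    ∀ c → f (zero , c) ≡ f (suc zero , c) → g (zero , c) ≡ g (suc zero , c)
  vertical-transfer         f g v c zero    = does-transfer (_ ≟ _) (_ ≟ _) v
  vertical-transfer {suc m} f g v c (suc j) with ∷-injective c
  ... | e , c′ = vertical-transfer (f ∘ next) (g ∘ next) (cong proj₁ e) c′ j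

  horizontal-transfer : ∀ {m} (f : Square (suc m) → Fin k) (g : Square (suc m) → Fin l) →
    tailCode f ≡ tailCode g → ∀ r i j → toℕ j ≡ suc (toℕ i) →
    f (r , i) ≡ f (r , j) → g (r , i) ≡ g (r , j)
  horizontal-transfer {suc m} f g c zero       zero    (suc zero) _ =
    does-transfer (_ ≟ _) (_ ≟ _) (cong (proj₁ ∘ proj₂) (proj₁ (∷-injective c)))
  horizontal-transfer {suc m} f g c (suc zero) zero    (suc zero) _ =
    does-transfer (_ ≟ _) (_ ≟ _) (cong (proj₂ ∘ proj₂) (proj₁ (∷-injective c)))
  horizontal-transfer {suc m} f g c r          (suc i) (suc j)    e =
    horizontal-transfer (f ∘ next) (g ∘ next) (proj₂ (∷-injective c)) r i j (suc-injective e)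

  adjacent-transfer : ∀ {m} (f : Square (suc m) → Fin k) (g : Square (suc m) → Fin l) →
    vertical f ≡ vertical g → tailCode f ≡ tailCode g →
    ∀ {x y} → Adjacent x y → f x ≡ f y → g x ≡ g y
  adjacent-transfer f g v c {r , i} {_ , j} (inj₁ (refl , inj₁ e)) = horizontal-transfer f g c r i j e
  adjacent-transfer f g v c {r , i} {_ , j} (inj₁ (refl , inj₂ e)) =
    sym ∘ horizontal-transfer f g c r j i e ∘ sym
  adjacent-transfer f g v c {zero , i}     {suc zero , _} (inj₂ (_ , refl)) = vertical-transfer f g v c i
  adjacent-transfer f g v c {suc zero , i} {zero , _}     (inj₂ (_ , refl)) =
    sym ∘ vertical-transfer f g v c i ∘ sym
  adjacent-transfer f g v c {zero , _}     {zero , _}     (inj₂ (inj₁ () , _))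
  adjacent-transfer f g v c {zero , _}     {zero , _}     (inj₂ (inj₂ () , _))
  adjacent-transfer f g v c {suc zero , _} {suc zero , _} (inj₂ (inj₁ () , _))
  adjacent-transfer f g v c {suc zero , _} {suc zero , _} (inj₂ (inj₂ () , _))

  -- Squares with the same `f`-label are joined by a path inside their piece. Every step of it is an
  -- adjacent pair recorded as joined in the common code, so `g` is constant along the path.
  kernel-transfer : ∀ {m} {f : Square (suc m) → Fin k} {g : Square (suc m) → Fin l} → IsPartition f →
    vertical f ≡ vertical g → tailCode f ≡ tailCode g → ∀ {x y} → f x ≡ f y → g x ≡ g y
  kernel-transfer {f = f} {g} P v c e = along (linked P e)
    where
    along : ∀ {x y} → Linked f x y → g x ≡ g y
    along ε               = refl
    along ((e , adj) ◅ p) = trans (adjacent-transfer f g v c adj e) (along p)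

-- Representatives of the pieces of `f`, one for each, have pairwise distinct `g`-labels.
pieces-≤ : ∀ {n k l} {f : Square n → Fin k} {g : Square n → Fin l} → IsPartition f →
           (∀ {x y} → g x ≡ g y → f x ≡ f y) → k ≤ l
pieces-≤ {f = f} {g} P g⇒f = injective⇒≤ {f = λ i → g (proj₁ (onto P i))} λ {i} {j} e →
  trans (sym (proj₂ (onto P i))) (trans (g⇒f e) (proj₂ (onto P j)))

pieces-unique : ∀ {m k l} {f : Square (suc m) → Fin k} {g : Square (suc m) → Fin l} →
  IsPartition f → IsPartition g → vertical f ≡ vertical g → tailCode f ≡ tailCode g → k ≡ l
pieces-unique P Q v c = ≤-antisym (pieces-≤ P (kernel-transfer Q (sym v) (sym c)))
                                  (pieces-≤ Q (kernel-transfer P v c))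

-- Around a cycle of four squares, three equalities force the fourth by transitivity.
closed-does : ∀ {k} (a b c d : Fin k) →
  T (closed (does (a ≟ b)) (does (c ≟ d)) (does (a ≟ c)) (does (b ≟ d)))
closed-does a b c d with a ≟ b | c ≟ d | a ≟ c | b ≟ d
... | yes refl | yes refl | yes refl | yes _ = tt
... | yes refl | yes refl | yes refl | no ¬e = ¬e refl
... | yes refl | no ¬e | yes refl | yes refl = ¬e refl
... | yes _ | no _ | yes _ | no _ = tt
... | yes refl | yes refl | no ¬e | yes refl = ¬e refl
... | yes _ | yes _ | no _ | no _ = tt
... | yes _ | no _ | no _ | yes _ = tt
... | yes _ | no _ | no _ | no _ = tt
... | no ¬e | yes refl | yes refl | yes refl = ¬e refl
... | no _ | yes _ | yes _ | no _ = tt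
... | no _ | yes _ | no _ | _ = tt
... | no _ | no _ | _ | _ = tt

valid-code : ∀ {m k} (f : Square (suc m) → Fin k) → T (valid (vertical f) (tailCode f))
valid-code {zero}  f = tt
valid-code {suc m} f =
  Equivalence.from T-∧ (closed-does (f (zero , zero)) (f (suc zero , zero)) _ _ , valid-code (f ∘ next))

last-code : ∀ {m k} (f : Square (suc m) → Fin k) →
  last (vertical f) (tailCode f) ≡ does (f (zero , fromℕ m) ≟ f (suc zero , fromℕ m))
last-code {zero}  f = refl
last-code {suc m} f = last-code (f ∘ next)

-- The canonical labelling of a code.

column : ∀ v s t {p} → (Fin 2 → Fin p) → Fin 2 → Fin (weight v s t + p)
column true  true  _     g _          = g zero
column true  false true  g _          = g (suc zero)
column true  false false g _          = zero
column false true  true  g r          = g r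
column false true  false g zero       = suc (g zero)
column false true  false g (suc zero) = zero
column false false true  g zero       = zero
column false false true  g (suc zero) = suc (g (suc zero))
column false false false g zero       = zero
column false false false g (suc zero) = suc zero

singleColumn : ∀ v → Fin 2 → Fin (base v)
singleColumn true  _ = zero
singleColumn false r = r

-- Columns are added on the left. Pieces that begin in the new column take the numbers below
-- `weight v s t`, and all earlier labels are raised by that amount.
label : ∀ {m} v (c : Tail m) → Square (suc m) → Fin (pieces v c)
label v []                 (r , _)     = singleColumn v r
label v ((v′ , s , t) ∷ c) (r , zero)  = column v s t (λ r → label v′ c (r , zero)) r
label v ((v′ , s , t) ∷ c) (r , suc j) = weight v s t ↑ʳ label v′ c (r , j)

≟-diag : ∀ {k} (i : Fin k) → does (i ≟ i) ≡ true
≟-diag i = dec-true (i ≟ i) refl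

column-code : ∀ v v′ s t {p} (g : Fin 2 → Fin p) → does (g zero ≟ g (suc zero)) ≡ v′ →
  T (closed v v′ s t) →
  let col = column v s t g ; w = weight v s t in
  does (col zero ≟ col (suc zero)) ≡ v × does (col zero ≟ w ↑ʳ g zero) ≡ s ×
  does (col (suc zero) ≟ w ↑ʳ g (suc zero)) ≡ t
column-code true  true  true  true  g e _ = ≟-diag (g zero) , ≟-diag (g zero) , e
column-code true  false true  false g e _ = ≟-diag (g zero) , ≟-diag (g zero) , e
-- Both new squares carry the label of the lower neighbour, so the top edge compares `g (suc zero)`
-- with `g zero`, which is `e` with its sides exchanged.
column-code true  false false true  g e _ =
  ≟-diag (g (suc zero)) ,
  trans (does-⇔ (mk⇔ sym sym) (g (suc zero) ≟ g zero) (g zero ≟ g (suc zero))) e ,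
  ≟-diag (g (suc zero))
column-code true  _     false false g e _ = refl , refl , refl
column-code false false true  true  g e _ = e , ≟-diag (g zero) , ≟-diag (g (suc zero))
column-code false _     true  false g e _ = refl , ≟-diag (g zero) , refl
column-code false _     false true  g e _ = refl , refl , ≟-diag (g (suc zero))
column-code false _     false false g e _ = refl , refl , refl

-- Raising labels by `w` preserves the kernel, so by induction the columns to the right keep their
-- code; validity makes the new column reproduce its own bits.
label-code : ∀ {m} v (c : Tail m) → T (valid v c) →
             vertical (label v c) ≡ v × tailCode (label v c) ≡ c
label-code true  [] _ = refl , refl
label-code false [] _ = refl , refl
label-code v ((v′ , s , t) ∷ c) ok with Equivalence.to (T-∧ {closed v v′ s t}) ok
... | cl , ok′ with label-code v′ c ok′
... | ev , ec with column-code v v′ s t (λ r → label v′ c (r , zero)) ev cl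
... | e₁ , e₂ , e₃ = e₁ , cong₂ _∷_
        (cong₂ _,_ (trans (vertical-cong {f = (w ↑ʳ_) ∘ label v′ c} {label v′ c} shifted) ev)
                   (cong₂ _,_ e₂ e₃))
        (trans (tailCode-cong {f = (w ↑ʳ_) ∘ label v′ c} shifted) ec)
  where
  w = weight v s t
  shifted : SameKernel ((w ↑ʳ_) ∘ label v′ c) (label v′ c)
  shifted x y = mk⇔ (↑ʳ-injective w _ _) (cong (w ↑ʳ_))

column-onto : ∀ v s t {p} (g : Fin 2 → Fin p) i →
  (∃[ j ] weight v s t ↑ʳ j ≡ i) ⊎ (∃[ r ] column v s t g r ≡ i)
column-onto true  true  _     g i             = inj₁ (i , refl)
column-onto true  false true  g i             = inj₁ (i , refl)
column-onto true  false false g zero          = inj₂ (zero , refl)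
column-onto true  false false g (suc i)       = inj₁ (i , refl)
column-onto false true  true  g i             = inj₁ (i , refl)
column-onto false true  false g zero          = inj₂ (suc zero , refl)
column-onto false true  false g (suc i)       = inj₁ (i , refl)
column-onto false false true  g zero          = inj₂ (zero , refl)
column-onto false false true  g (suc i)       = inj₁ (i , refl)
column-onto false false false g zero          = inj₂ (zero , refl)
column-onto false false false g (suc zero)    = inj₂ (suc zero , refl)
column-onto false false false g (suc (suc i)) = inj₁ (i , refl)

-- This keeps pieces connected: a new square with an old label reaches the old columns through a row
-- `r′` whose horizontal edge lies inside the piece. The absurd cases are the fresh labels.
column-attached : ∀ v s t {p} (g : Fin 2 → Fin p) r j →
  let col = column v s t g ; w = weight v s t in
  col r ≡ w ↑ʳ j → ∃[ r′ ] col r ≡ col r′ × col r′ ≡ w ↑ʳ g r′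
column-attached true  true  _     g r          j _ = zero , refl , refl
column-attached true  false true  g r          j _ = suc zero , refl , refl
column-attached true  false false g r          j ()
column-attached false true  true  g r          j _ = r , refl , refl
column-attached false true  false g zero       j _ = zero , refl , refl
column-attached false true  false g (suc zero) j ()
column-attached false false true  g zero       j ()
column-attached false false true  g (suc zero) j _ = suc zero , refl , refl
column-attached false false false g zero       j ()
column-attached false false false g (suc zero) j ()

vertical-linked : ∀ {n k} (f : Square n → Fin k) r r′ c → f (r , c) ≡ f (r′ , c) →
                  Linked f (r , c) (r′ , c)
vertical-linked f zero       zero       c e = ε
vertical-linked f zero       (suc zero) c e = (e , inj₂ (inj₁ refl , refl)) ◅ ε
vertical-linked f (suc zero) zero       c e = (e , inj₂ (inj₂ refl , refl)) ◅ ε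
vertical-linked f (suc zero) (suc zero) c e = ε

label-isPartition : ∀ {m} v (c : Tail m) → IsPartition (label v c)
label-isPartition true [] = record
  { onto   = λ { zero → (zero , zero) , refl }
  ; linked = λ { {r , zero} {r′ , zero} → vertical-linked (label true []) r r′ zero }
  }
label-isPartition false [] = record
  { onto   = λ i → (i , zero) , refl
  ; linked = λ { {r , zero} {r′ , zero} → vertical-linked (label false []) r r′ zero }
  }
label-isPartition {suc m} v ((v′ , s , t) ∷ c) = record { onto = onto′ ; linked = linked′ }
  where
  w = weight v s t
  g = label v′ c
  f = label v ((v′ , s , t) ∷ c)
  P = label-isPartition v′ c
  col = λ r → g (r , zero)

  onto′ : ∀ i → ∃[ x ] f x ≡ i
  onto′ i with column-onto v s t col i
  ... | inj₁ (j , refl) = let (x , e) = onto P j in next x , cong (w ↑ʳ_) e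
  ... | inj₂ (r , e)    = (r , zero) , e

  linked-next : ∀ {x y} → f (next x) ≡ f (next y) → Linked f (next x) (next y)
  linked-next e = Star.gmap next (map (cong (w ↑ʳ_)) Adjacent-next) (linked P (↑ʳ-injective w _ _ e))

  linked-column : ∀ r y → f (r , zero) ≡ f (next y) → Linked f (r , zero) (next y)
  linked-column r y e with column-attached v s t col r (g y) e
  ... | r′ , e₁ , e₂ =
    -- The path goes vertically to the attached row, crosses the horizontal edge, and continues
    -- within the old board by induction.
    vertical-linked f r r′ zero e₁ ◅◅
    (e₂ , inj₁ (refl , inj₁ refl)) ◅ linked-next {r′ , zero} {y} (trans (sym e₂) (trans (sym e₁) e))

  linked′ : ∀ {x y} → f x ≡ f y → Linked f x y
  linked′ {r , zero}  {r′ , zero}   e = vertical-linked f r r′ zero e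
  linked′ {r , zero}  {r′ , suc j′} e = linked-column r (r′ , j′) e
  linked′ {r , suc j} {r′ , zero}   e = Linked-sym (linked-column r′ (r , j) (sym e))
  linked′ {r , suc j} {r′ , suc j′} e = linked-next e

-- Divisions as labellings.

owner : ∀ {k n} → Division k n → Square n → Fin k
owner D x = proj₁ (partition D x)

owner-∈ : ∀ {k n} (D : Division k n) x → squares (piece D (owner D x)) x
owner-∈ D x = proj₁ (proj₂ (partition D x))

owner-unique : ∀ {k n} (D : Division k n) {x i} → squares (piece D i) x → owner D x ≡ i
owner-unique D {x} = proj₂ (proj₂ (partition D x))

owner-isPartition : ∀ {k n} (D : Division k n) → IsPartition (owner D)
owner-isPartition D = record
  { onto   = λ i → map₂ (owner-unique D) (nonempty (piece D i))
  ; linked = λ {x} {y} e → Star.map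
      (λ (u∈ , v∈ , adj) → trans (owner-unique D u∈) (sym (owner-unique D v∈)) , adj)
      (connected (piece D (owner D x)) (owner-∈ D x) (subst (λ i → squares (piece D i) y) (sym e) (owner-∈ D y)))
  }

division : ∀ {k n} {f : Square n → Fin k} → IsPartition f → Division k n
division {f = f} P = record
  { piece     = λ i → record
    { squares   = λ x → f x ≡ i
    ; nonempty  = onto P i
    ; connected = λ x∈ y∈ → within x∈ (linked P (trans x∈ (sym y∈)))
    }
  ; partition = λ x → f x , refl , id
  }
  where
  within : ∀ {i x y} → f x ≡ i → Linked f x y → Star (λ u v → f u ≡ i × f v ≡ i × Adjacent u v) x y
  within x∈ ε               = ε
  within x∈ ((e , adj) ◅ p) = (x∈ , trans (sym e) x∈ , adj) ◅ within (trans (sym e) x∈) p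

-- With its converse below, this turns equality of divisions up to numbering into equality of
-- kernels, which codes detect.
≈ᴰ⇒SameKernel : ∀ {k n} (D E : Division k n) → D ≈ᴰ E → SameKernel (owner D) (owner E)
≈ᴰ⇒SameKernel D E (D⊑E , E⊑D) x y = mk⇔ (refine D E D⊑E) (refine E D E⊑D)
  where
  refine : ∀ {k n} (D E : Division k n) {x y} →
           (∀ i → ∃[ j ] squares (piece D i) ≐ squares (piece E j)) →
           owner D x ≡ owner D y → owner E x ≡ owner E y
  refine D E {x} {y} D⊑E e with D⊑E (owner D x)
  ... | j , (D⊆E , _) = trans (owner-unique E (D⊆E (owner-∈ D x)))
    (sym (owner-unique E (D⊆E (subst (λ i → squares (piece D i) y) (sym e) (owner-∈ D y)))))

SameKernel⇒≈ᴰ : ∀ {k n} (D E : Division k n) → SameKernel (owner D) (owner E) → D ≈ᴰ E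
SameKernel⇒≈ᴰ D E D∼E =
  refine D E D∼E , refine E D λ x y → mk⇔ (from (D∼E x y)) (to (D∼E x y))
  where
  open Equivalence
  refine : ∀ {k n} (D E : Division k n) → SameKernel (owner D) (owner E) →
           ∀ i → ∃[ j ] squares (piece D i) ≐ squares (piece E j)
  -- The piece matching `i` is the one that owns, in `E`, a chosen square of piece `i`.
  refine D E D∼E i = let (x , x∈) = nonempty (piece D i) in owner E x ,
    (λ {y} y∈ → subst (λ j → squares (piece E j) y)
       (to (D∼E y x) (trans (owner-unique D y∈) (sym (owner-unique D x∈)))) (owner-∈ E y)) ,
    (λ {y} y∈ → subst (λ j → squares (piece D j) y)
       (trans (from (D∼E y x) (owner-unique E y∈)) (owner-unique D x∈)) (owner-∈ D y))

good-code : ∀ q {k m} (D : Division k (suc m)) →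
  let f = owner D in T (q (does (f (zero , fromℕ m) ≟ f (suc zero , fromℕ m)))) →
  T (good q k (vertical f) (tailCode f))
good-code q {k} D qD = Equivalence.from T-∧ (valid-code f , Equivalence.from T-∧
  ( subst (T ∘ q) (sym (last-code f)) qD
  -- The labelling `label v c` has `pieces v c` pieces and the same code as `owner D`, which has
  -- `k`; equal codes force equal numbers of pieces.
  , ≡⇒≡ᵇ _ k (pieces-unique (label-isPartition v c) (owner-isPartition D) (proj₁ same) (proj₂ same))))
  where
  f = owner D
  v = vertical f
  c = tailCode f
  same = label-code v c (valid-code f)

-- Bijection between divisions and codes.

module _ (q : Bool → Bool) (k m : ℕ) where

  Code : Set
  Code = Σ Bool λ v → Σ (Tail m) λ c → T (good q k v c)

  Code-≡ : {c d : Code} → proj₁ c ≡ proj₁ d → proj₁ (proj₂ c) ≡ proj₁ (proj₂ d) → c ≡ d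
  Code-≡ {v , c , p} {_ , _ , p′} refl refl = cong (λ p → v , c , p) (T-irrelevant p p′)

  realize : ∀ v (c : Tail m) → T (good q k v c) → Σ (Division k (suc m)) λ D →
    T (q (does (owner D (zero , fromℕ m) ≟ owner D (suc zero , fromℕ m)))) ×
    vertical (owner D) ≡ v × tailCode (owner D) ≡ c
  realize v c p with Equivalence.to (T-∧ {valid v c}) p
  ... | ok , p′ with Equivalence.to (T-∧ {q (last v c)}) p′
  ... | qc , p″ with ≡ᵇ⇒≡ (pieces v c) k p″
  ... | refl with label-code v c ok
  ... | ev , ec = division (label-isPartition v c) ,
    subst (T ∘ q) (trans (cong₂ last (sym ev) (sym ec)) (last-code (label v c))) qc , ev , ec

  -- Stated for any setoid that `π` identifies with the divisions whose rightmost column passes `q`,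
  -- so that all divisions and the split ones are counted by one argument.
  cardinality : ∀ {a ℓ} (S : Setoid a ℓ) (let open Setoid S) (π : Carrier → Division k (suc m)) →
    (∀ {x y} → x ≈ y ⇔ π x ≈ᴰ π y) →
    (∀ x → let f = owner (π x) in T (q (does (f (zero , fromℕ m) ≟ f (suc zero , fromℕ m))))) →
    (∀ D → let f = owner D in T (q (does (f (zero , fromℕ m) ≟ f (suc zero , fromℕ m)))) →
           ∃[ x ] π x ≡ D) →
    HasCardinality S (∑ᵇ λ v → count q m v k)
  cardinality S π π-≈ π-q π-onto = record
    { to        = Inverse.to index ∘ code
    ; cong      = cong (Inverse.to index) ∘ code-cong
    ; bijective = code-injective ∘ Injection.injective (Inverse⇒Injection index) , onto-Fin
    }
    where
    open Setoid S using (Carrier; _≈_)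

    index : Code ↔ Fin (∑ᵇ λ v → count q m v k)
    index = ∑ᵇ-↔ λ v → #-↔ (good q k v)

    code : Carrier → Code
    code x = vertical (owner (π x)) , tailCode (owner (π x)) , good-code q (π x) (π-q x)

    code-cong : ∀ {x y} → x ≈ y → code x ≡ code y
    code-cong {x} {y} x≈y = Code-≡ (vertical-cong ker) (tailCode-cong ker)
      where ker = ≈ᴰ⇒SameKernel (π x) (π y) (Equivalence.to π-≈ x≈y)

    code-injective : ∀ {x y} → code x ≡ code y → x ≈ y
    code-injective {x} {y} e = Equivalence.from π-≈ (SameKernel⇒≈ᴰ (π x) (π y) λ _ _ →
      mk⇔ (kernel-transfer (owner-isPartition (π x)) ev ec)
          (kernel-transfer (owner-isPartition (π y)) (sym ev) (sym ec)))
      where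
      ev = cong proj₁ e
      ec = cong (proj₁ ∘ proj₂) e

    code-onto : ∀ c → ∃[ x ] code x ≡ c
    code-onto (v , c , p) with realize v c p
    ... | D , qD , ev , ec with π-onto D qD
    ... | x , refl = x , Code-≡ ev ec

    onto-Fin : ∀ i → ∃[ x ] (∀ {z} → z ≈ x → Inverse.to index (code z) ≡ i)
    onto-Fin i with code-onto (Inverse.from index i)
    ... | x , e = x , λ z≈x → trans (cong (Inverse.to index) (trans (code-cong z≈x) e))
                                    (Inverse.strictlyInverseˡ index i)

divisions-cardinality : ∀ k m → d[ k , suc m ]≔ (∑ᵇ λ v → count (const true) m v k)
divisions-cardinality k m =
  cardinality (const true) k m (divisions k (suc m)) id (⇔-id _) (λ _ → tt) (λ D _ → D , refl)

splitDivisions-cardinality : ∀ k m → s[ k , suc m ]≔ (∑ᵇ λ v → count not m v k)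
splitDivisions-cardinality k m =
  cardinality not k m (splitDivisions k (suc m)) proj₁ (⇔-id _) splits⇒ (λ D s → (D , ⇒splits D s) , refl)
  where
  splits⇒ : (D : Σ (Division k (suc m)) SplitsRightmost) → let f = owner (proj₁ D) in
            T (not (does (f (zero , fromℕ m) ≟ f (suc zero , fromℕ m))))
  splits⇒ (D , i , j , i≢j , x∈ , y∈) = subst (T ∘ not) (sym (dec-false (_ ≟ _) λ e →
    i≢j (trans (sym (owner-unique D x∈)) (trans e (owner-unique D y∈))))) tt

  ⇒splits : (D : Division k (suc m)) → let f = owner D in
            T (not (does (f (zero , fromℕ m) ≟ f (suc zero , fromℕ m)))) → SplitsRightmost D
  ⇒splits D p with owner D (zero , fromℕ m) ≟ owner D (suc zero , fromℕ m)
  ... | no ≢ = _ , _ , ≢ , owner-∈ D _ , owner-∈ D _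

-- Newton expansions

Counts : Set
Counts = Bool → ℕ → ℕ

shift-cong : ∀ w {f g : ℕ → ℕ} → (∀ k → f k ≡ g k) → ∀ k → shift 0 w f k ≡ shift 0 w g k
shift-cong zero    f≡g k       = f≡g k
shift-cong (suc w) f≡g zero    = refl
shift-cong (suc w) f≡g (suc k) = shift-cong w f≡g k

shift-+ : ∀ w (f g : ℕ → ℕ) k → shift 0 w (λ k → f k + g k) k ≡ shift 0 w f k + shift 0 w g k
shift-+ zero    f g k       = refl
shift-+ (suc w) f g zero    = refl
shift-+ (suc w) f g (suc k) = shift-+ w f g k

growth-cong : ∀ {f g : Counts} → (∀ v k → f v k ≡ g v k) → ∀ v k → growth f v k ≡ growth g v k
growth-cong f≡g true  k = cong₂ _+_ (cong₂ _+_ (cong (2 *_) (f≡g false k))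
  (shift-cong 1 (f≡g true) k)) (shift-cong 1 (f≡g false) k)
growth-cong f≡g false k = cong₂ _+_ (cong₂ _+_ (cong₂ _+_
  (cong (2 *_) (shift-cong 1 (f≡g true) k)) (cong (2 *_) (shift-cong 1 (f≡g false) k)))
  (shift-cong 2 (f≡g true) k)) (shift-cong 2 (f≡g false) k)

-- Additivity carries a recurrence for `f` over to `growth ∘ f`, which allows differences to be
-- iterated.
growth-+ : ∀ (f g : Counts) v k → growth (λ v k → f v k + g v k) v k ≡ growth f v k + growth g v k
growth-+ f g true  k rewrite shift-+ 1 (f true) (g true) k | shift-+ 1 (f false) (g false) k =
  solve 6 (λ a b c a′ b′ c′ →
    con 2 :* (a :+ a′) :+ (b :+ b′) :+ (c :+ c′) :=
    (con 2 :* a :+ b :+ c) :+ (con 2 :* a′ :+ b′ :+ c′)) refl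
    (f false k) (shift 0 1 (f true) k) (shift 0 1 (f false) k)
    (g false k) (shift 0 1 (g true) k) (shift 0 1 (g false) k)
  where open +-*-Solver
growth-+ f g false k rewrite shift-+ 1 (f true) (g true) k | shift-+ 1 (f false) (g false) k
                           | shift-+ 2 (f true) (g true) k | shift-+ 2 (f false) (g false) k =
  solve 8 (λ a b c d a′ b′ c′ d′ →
    con 2 :* (a :+ a′) :+ con 2 :* (b :+ b′) :+ (c :+ c′) :+ (d :+ d′) :=
    (con 2 :* a :+ con 2 :* b :+ c :+ d) :+ (con 2 :* a′ :+ con 2 :* b′ :+ c′ :+ d′)) refl
    (shift 0 1 (f true) k) (shift 0 1 (f false) k) (shift 0 2 (f true) k) (shift 0 2 (f false) k)
    (shift 0 1 (g true) k) (shift 0 1 (g false) k) (shift 0 2 (g true) k) (shift 0 2 (g false) k)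
  where open +-*-Solver

-- Applying `growth` innermost makes dropping the first Newton coefficient of `f` definitionally the
-- passage to `growth f`.
growths : ℕ → Counts → Counts
growths zero    f = f
growths (suc i) f = growths i (growth f)

-- The sequence with iterated differences a at 0, that is n ↦ ∑ᵢ aᵢ C(n,i).
newton : (ℕ → ℕ) → ℕ → ℕ
newton a zero    = a 0
newton a (suc n) = newton a n + newton (a ∘ suc) n

newton-+ : ∀ a b n → newton (λ i → a i + b i) n ≡ newton a n + newton b n
newton-+ a b zero    = refl
newton-+ a b (suc n) rewrite newton-+ a b n | newton-+ (a ∘ suc) (b ∘ suc) n =
  solve 4 (λ x y x′ y′ → x :+ y :+ (x′ :+ y′) := x :+ x′ :+ (y :+ y′)) refl
    (newton a n) (newton b n) (newton (a ∘ suc) n) (newton (b ∘ suc) n)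
  where open +-*-Solver

-- The difference sequence of `f` is `growth ∘ f`, which obeys the same recurrence; induction on n
-- then follows the recursion of `newton`.
newton-growths : (f : ℕ → Counts) → (∀ m v k → f (suc m) v k ≡ f m v k + growth (f m) v k) →
                 ∀ n v k → f n v k ≡ newton (λ i → growths i (f 0) v k) n
newton-growths f f-suc zero    v k = refl
newton-growths f f-suc (suc n) v k = trans (f-suc n v k)
  (cong₂ _+_ (newton-growths f f-suc n v k) (newton-growths (growth ∘ f) growth-suc n v k))
  where
  growth-suc : ∀ m v k → growth (f (suc m)) v k ≡ growth (f m) v k + growth (growth (f m)) v k
  growth-suc m v k = trans (growth-cong (f-suc m) v k) (growth-+ (f m) (growth (f m)) v k)

-- Vanishing and positivity of iterated differences.

Vanishing : ℕ → Counts → Set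
Vanishing e f = (∀ k → k * 2 ≤ 1 + e → f true k ≡ 0) × (∀ k → k * 2 ≤ 2 + e → f false k ≡ 0)

shift-vanishing : ∀ w {b} {f : ℕ → ℕ} → (∀ k → k * 2 ≤ b → f k ≡ 0) →
                  ∀ k → k * 2 ≤ w * 2 + b → shift 0 w f k ≡ 0
shift-vanishing zero    f0 k       le = f0 k le
shift-vanishing (suc w) f0 zero    le = refl
shift-vanishing (suc w) f0 (suc k) le =
  shift-vanishing w f0 k (s≤s⁻¹ (s≤s⁻¹ le))

-- The bounds on 2k for joined and split columns are offset by one so that each `growth` raises both
-- by exactly one. The tight terms are `f false k` in the joined count and the once shifted `f true`
-- in the split count; the others have slack.
growth-vanishing : ∀ {e f} → Vanishing e f → Vanishing (suc e) (growth f)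
growth-vanishing {e} {f} (f0 , f1) = joined , split
  where
  joined : ∀ k → k * 2 ≤ 2 + e → growth f true k ≡ 0
  joined k le rewrite f1 k le
    | shift-vanishing 1 f0 k (≤-trans le (n≤1+n _))
    | shift-vanishing 1 f1 k (≤-trans le (m≤n+m _ 2)) = refl
  split : ∀ k → k * 2 ≤ 3 + e → growth f false k ≡ 0
  split k le rewrite shift-vanishing 1 f0 k le
    | shift-vanishing 1 f1 k (≤-trans le (n≤1+n _))
    | shift-vanishing 2 f0 k (≤-trans le (m≤n+m _ 2))
    | shift-vanishing 2 f1 k (≤-trans le (m≤n+m _ 3)) = refl

growths-vanishing : ∀ i {e f} → Vanishing e f → Vanishing (i + e) (growths i f)
growths-vanishing zero    f0 = f0
growths-vanishing (suc i) {e} {f} f0 =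
  subst (λ j → Vanishing j (growths i (growth f))) (+-suc i e)
        (growths-vanishing i (growth-vanishing {f = f} f0))

growth-true-pos : ∀ f {k} → 0 < f false k → 0 < growth f true k
growth-true-pos f {k} pos = ≤-trans pos (≤-trans (m≤m+n (f false k) _)
  (≤-trans (m≤m+n (2 * f false k) _) (m≤m+n (2 * f false k + shift 0 1 (f true) k) _)))

growth-false-pos : ∀ f {k} → 0 < f true k → 0 < growth f false (suc k)
growth-false-pos f {k} pos = ≤-trans pos (≤-trans (m≤m+n (f true k) _)
  (≤-trans (m≤m+n (2 * f true k) _) (≤-trans (m≤m+n (2 * f true k + 2 * f false k) _)
  (m≤m+n (2 * f true k + 2 * f false k + shift 0 1 (f true) k) _))))

-- The vanishing bound is sharp: passing from joined to split and back along the tight terms takes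
-- two applications of `growth` and raises k by one.
growths-pos : ∀ j f {k} → 0 < f true k → 0 < growths (j * 2) f true (j + k)
growths-pos zero    f pos = pos
growths-pos (suc j) f {k} pos = subst (λ l → 0 < growths (j * 2) (growth (growth f)) true l) (+-suc j k)
  (growths-pos j (growth (growth f)) (growth-true-pos (growth f) {suc k} (growth-false-pos f pos)))

-- Binomial coefficients and truncated Newton sums.

[1+n]*nCk≡[1+k]*[1+n]C[1+k] : ∀ n k → suc n * (n C k) ≡ suc k * (suc n C suc k)
[1+n]*nCk≡[1+k]*[1+n]C[1+k] n       zero    =
  trans (*-identityʳ (suc n)) (sym (trans (*-identityˡ (suc n C 1)) (nC1≡n (suc n))))
[1+n]*nCk≡[1+k]*[1+n]C[1+k] zero    (suc k) =
  sym (trans (cong (suc (suc k) *_) (k>n⇒nCk≡0 (s≤s (s≤s (z≤n {k}))))) (*-zeroʳ (suc (suc k))))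
[1+n]*nCk≡[1+k]*[1+n]C[1+k] (suc n) (suc k) = begin
  suc (suc n) * x
    ≡⟨ cong (λ z → x + suc n * z) (nCk+nC[k+1]≡[n+1]C[k+1] n k) ⟨
  x + suc n * (n C k + n C suc k)
    ≡⟨ cong (x +_) (*-distribˡ-+ (suc n) (n C k) (n C suc k)) ⟩
  x + (suc n * (n C k) + suc n * (n C suc k))
    ≡⟨ cong (x +_) (cong₂ _+_ ([1+n]*nCk≡[1+k]*[1+n]C[1+k] n k)
                              ([1+n]*nCk≡[1+k]*[1+n]C[1+k] n (suc k))) ⟩
  x + (suc k * x + suc (suc k) * y)
    ≡⟨ +-assoc x (suc k * x) _ ⟨
  suc (suc k) * x + suc (suc k) * y
    ≡⟨ *-distribˡ-+ (suc (suc k)) x y ⟨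
  suc (suc k) * (x + y)
    ≡⟨ cong (suc (suc k) *_) (nCk+nC[k+1]≡[n+1]C[k+1] (suc n) (suc k)) ⟩
  suc (suc k) * (suc (suc n) C suc (suc k)) ∎
  where
  open ≡-Reasoning
  x = suc n C suc k
  y = suc n C suc (suc k)

-- The sum of a_j C(n,i+j) for j from 0 to d. The offset `i` lets the first term be split off, as in
-- Horner's scheme.
binomialSum : ℕ → (ℕ → ℕ) → ℕ → ℕ → ℕ
binomialSum i a zero    n = a 0 * (n C i)
binomialSum i a (suc d) n = a 0 * (n C i) + binomialSum (suc i) (a ∘ suc) d n

binomialSum-pascal : ∀ i a d n →
  binomialSum (suc i) a d (suc n) ≡ binomialSum (suc i) a d n + binomialSum i a d n
binomialSum-pascal i a zero    n rewrite sym (nCk+nC[k+1]≡[n+1]C[k+1] n i) =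
  trans (*-distribˡ-+ (a 0) (n C i) _) (+-comm (a 0 * (n C i)) _)
binomialSum-pascal i a (suc d) n rewrite sym (nCk+nC[k+1]≡[n+1]C[k+1] n i)
                                       | binomialSum-pascal (suc i) (a ∘ suc) d n =
  solve 5 (λ a x y s t → a :* (x :+ y) :+ (s :+ t) := a :* y :+ s :+ (a :* x :+ t)) refl
    (a 0) (n C i) (n C suc i) (binomialSum (suc (suc i)) (a ∘ suc) d n)
    (binomialSum (suc i) (a ∘ suc) d n)
  where open +-*-Solver

binomialSum-zero : ∀ i a d → binomialSum (suc i) a d 0 ≡ 0
binomialSum-zero i a zero    = *-zeroʳ (a 0)
binomialSum-zero i a (suc d) rewrite *-zeroʳ (a 0) = binomialSum-zero (suc i) (a ∘ suc) d

-- By Pascal's rule the binomial sum satisfies the recursion of `newton` in n; the sum may stop at d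
-- because later differences vanish.
newton-binomialSum : ∀ a d → (∀ i → d < i → a i ≡ 0) → ∀ n → newton a n ≡ binomialSum 0 a d n
newton-binomialSum a zero    a≡0 zero    = sym (*-identityʳ (a 0))
newton-binomialSum a (suc d) a≡0 zero
  rewrite binomialSum-zero 0 (a ∘ suc) d = sym (trans (+-identityʳ _) (*-identityʳ (a 0)))
newton-binomialSum a zero    a≡0 (suc n)
  rewrite newton-binomialSum a 0 a≡0 n
        | newton-binomialSum (a ∘ suc) 0 (λ i _ → a≡0 (suc i) z<s) n
        | a≡0 1 z<s = +-identityʳ _
newton-binomialSum a (suc d) a≡0 (suc n)
  rewrite newton-binomialSum a (suc d) a≡0 n
        | newton-binomialSum (a ∘ suc) d (λ i d<i → a≡0 (suc i) (s≤s d<i)) n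
        | binomialSum-pascal 0 (a ∘ suc) d n =
  +-assoc (a 0 * (n C 0)) (binomialSum 1 (a ∘ suc) d n) (binomialSum 0 (a ∘ suc) d n)

-- Rational arithmetic.

fromNat-+ : ∀ m n → fromNat (m + n) ≡ fromNat m ℚ.+ fromNat n
-- `fromNat` normalises its fraction, so the computation takes place among unnormalised rationals.
fromNat-+ m n = ℚ.toℚᵘ-injective (begin
  toℚᵘ (fromNat (m + n))              ≈⟨ ℚ.toℚᵘ-fromℚᵘ (ℚᵘ.mkℚᵘ (ℤ.+ (m + n)) 0) ⟩
  ℚᵘ.mkℚᵘ (ℤ.+ (m + n)) 0               ≈⟨ ℚᵘ.*≡* (cong (ℤ._* ℤ.+ 1)
    (cong₂ ℤ._+_ (sym (ℤ.*-identityʳ (ℤ.+ m))) (sym (ℤ.*-identityʳ (ℤ.+ n))))) ⟩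
  ℚᵘ.mkℚᵘ (ℤ.+ m) 0 ℚᵘ.+ ℚᵘ.mkℚᵘ (ℤ.+ n) 0
    ≈⟨ ℚᵘ.+-cong (ℚ.toℚᵘ-fromℚᵘ (ℚᵘ.mkℚᵘ (ℤ.+ m) 0))
                (ℚ.toℚᵘ-fromℚᵘ (ℚᵘ.mkℚᵘ (ℤ.+ n) 0)) ⟨
  toℚᵘ (fromNat m) ℚᵘ.+ toℚᵘ (fromNat n) ≈⟨ ℚ.toℚᵘ-homo-+ (fromNat m) (fromNat n) ⟨
  toℚᵘ (fromNat m ℚ.+ fromNat n) ∎)
  where open ℚᵘ.≃-Reasoning

fromNat-* : ∀ m n → fromNat (m * n) ≡ fromNat m ℚ.* fromNat n
fromNat-* zero    n = sym (ℚ.*-zeroˡ (fromNat n))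
fromNat-* (suc m) n = begin
  fromNat (n + m * n)                     ≡⟨ fromNat-+ n (m * n) ⟩
  fromNat n ℚ.+ fromNat (m * n)           ≡⟨ cong (fromNat n ℚ.+_) (fromNat-* m n) ⟩
  fromNat n ℚ.+ fromNat m ℚ.* fromNat n
    ≡⟨ solve 2 (λ x y → y :+ x :* y := (con 1ℚ :+ x) :* y) refl (fromNat m) (fromNat n) ⟩
  (1ℚ ℚ.+ fromNat m) ℚ.* fromNat n        ≡⟨ cong (ℚ._* fromNat n) (sym (fromNat-+ 1 m)) ⟩
  fromNat (suc m) ℚ.* fromNat n ∎
  where open ≡-Reasoning
        open ℚ.+-*-Solver

fromNat≢0 : ∀ {n} → 0 < n → fromNat n ≢ 0ℚ
fromNat≢0 {suc n} _ eq with ℚ./-injective-≃ (ℚᵘ.mkℚᵘ (ℤ.+ suc n) 0) (ℚᵘ.mkℚᵘ (ℤ.+ 0) 0) eq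
... | ℚᵘ.*≡* ()

recip : ℕ → ℚ
recip i = ℤ.+ 1 ℚ./ suc i

recip-inverse : ∀ i → recip i ℚ.* fromNat (suc i) ≡ 1ℚ
recip-inverse i = ℚ.toℚᵘ-injective (begin
  toℚᵘ (recip i ℚ.* fromNat (suc i)) ≈⟨ ℚ.toℚᵘ-homo-* (recip i) (fromNat (suc i)) ⟩
  toℚᵘ (recip i) ℚᵘ.* toℚᵘ (fromNat (suc i))
    ≈⟨ ℚᵘ.*-cong (ℚ.toℚᵘ-fromℚᵘ (ℚᵘ.mkℚᵘ (ℤ.+ 1) i))
                (ℚ.toℚᵘ-fromℚᵘ (ℚᵘ.mkℚᵘ (ℤ.+ suc i) 0)) ⟩
  ℚᵘ.mkℚᵘ (ℤ.+ 1) i ℚᵘ.* ℚᵘ.mkℚᵘ (ℤ.+ suc i) 0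
    ≈⟨ ℚᵘ.*≡* (cong (ℤ.+_ ∘ suc) (trans (*-identityʳ (i + 0)) (sym (cong (_+ 0) (*-identityʳ i))))) ⟩
  ℚᵘ.1ℚᵘ ∎)
  where open ℚᵘ.≃-Reasoning

-- Polynomials in Horner form.

-- The polynomial r + (α x + β) p.
horner : ℚ → ℚ → ℚ → Poly → Poly
horner r α β []      = r ∷ []
horner r α β (c ∷ p) = r ℚ.+ β ℚ.* c ∷ horner (α ℚ.* c) α β p

eval-horner : ∀ r α β p x → eval (horner r α β p) x ≡ r ℚ.+ (α ℚ.* x ℚ.+ β) ℚ.* eval p x
eval-horner r α β []      x = solve 4 (λ r α β x →
    r :+ x :* con 0ℚ := r :+ (α :* x :+ β) :* con 0ℚ) refl r α β x
  where open ℚ.+-*-Solver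
eval-horner r α β (c ∷ p) x rewrite eval-horner (α ℚ.* c) α β p x = solve 6 (λ r α β x c e →
    r :+ β :* c :+ x :* (α :* c :+ (α :* x :+ β) :* e) := r :+ (α :* x :+ β) :* (c :+ x :* e))
    refl r α β x c (eval p x)
  where open ℚ.+-*-Solver

coeff-horner-zero : ∀ r α β p → coeff (horner r α β p) 0 ≡ r ℚ.+ β ℚ.* coeff p 0
coeff-horner-zero r α β []      = solve 2 (λ r β → r := r :+ β :* con 0ℚ) refl r β
  where open ℚ.+-*-Solver
coeff-horner-zero r α β (c ∷ p) = refl

coeff-horner-suc : ∀ r α β p i →
  coeff (horner r α β p) (suc i) ≡ α ℚ.* coeff p i ℚ.+ β ℚ.* coeff p (suc i)
coeff-horner-suc r α β []      i       = solve 2 (λ α β → con 0ℚ := α :* con 0ℚ :+ β :* con 0ℚ) refl α β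
  where open ℚ.+-*-Solver
coeff-horner-suc r α β (c ∷ p) zero    = coeff-horner-zero (α ℚ.* c) α β p
coeff-horner-suc r α β (c ∷ p) (suc i) = coeff-horner-suc (α ℚ.* c) α β p i

-- The new leading coefficient is 1/(i+1) times the old one; multiplying by i+1 recovers the old
-- one, so it cannot be zero.
horner-degree : ∀ r i β p d → HasDegree p d → HasDegree (horner r (recip i) β p) (suc d)
horner-degree r i β p d (top , above) = top′ , above′
  where
  open ≡-Reasoning
  open ℚ.+-*-Solver
  top′ : coeff (horner r (recip i) β p) (suc d) ≢ 0ℚ
  top′ eq = top (begin
    coeff p d ≡⟨ ℚ.*-identityˡ (coeff p d) ⟨
    1ℚ ℚ.* coeff p d ≡⟨ cong (ℚ._* coeff p d) (recip-inverse i) ⟨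
    recip i ℚ.* fromNat (suc i) ℚ.* coeff p d
      ≡⟨ solve 4 (λ a b c β → a :* b :* c := b :* (a :* c :+ β :* con 0ℚ))
                 refl (recip i) (fromNat (suc i)) (coeff p d) β ⟩
    fromNat (suc i) ℚ.* (recip i ℚ.* coeff p d ℚ.+ β ℚ.* 0ℚ)
      ≡⟨ cong (λ z → fromNat (suc i) ℚ.* (recip i ℚ.* coeff p d ℚ.+ β ℚ.* z)) (above (suc d) ≤-refl) ⟨
    fromNat (suc i) ℚ.* (recip i ℚ.* coeff p d ℚ.+ β ℚ.* coeff p (suc d))
      ≡⟨ cong (fromNat (suc i) ℚ.*_) (trans (sym (coeff-horner-suc r (recip i) β p d)) eq) ⟩
    fromNat (suc i) ℚ.* 0ℚ ≡⟨ ℚ.*-zeroʳ (fromNat (suc i)) ⟩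
    0ℚ ∎)
  above′ : ∀ j → suc d < j → coeff (horner r (recip i) β p) j ≡ 0ℚ
  above′ (suc j) (s≤s d<j)
    rewrite coeff-horner-suc r (recip i) β p j | above j d<j | above (suc j) (m<n⇒m<1+n d<j) =
    solve 2 (λ α β → α :* con 0ℚ :+ β :* con 0ℚ := con 0ℚ) refl (recip i) β

-- The factor x/(i+1) − 1 takes C(x−1,i) to C(x−1,i+1).
newtonPoly : ℕ → (ℕ → ℕ) → ℕ → Poly
newtonPoly i a zero    = fromNat (a 0) ∷ []
newtonPoly i a (suc d) = horner (fromNat (a 0)) (recip i) (ℚ.- 1ℚ) (newtonPoly (suc i) (a ∘ suc) d)

newtonPoly-degree : ∀ i a d → 0 < a d → HasDegree (newtonPoly i a d) d
newtonPoly-degree i a zero    pos = fromNat≢0 pos , λ { (suc j) _ → refl }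
newtonPoly-degree i a (suc d) pos = horner-degree (fromNat (a 0)) i (ℚ.- 1ℚ) (newtonPoly (suc i) (a ∘ suc) d) d
    (newtonPoly-degree (suc i) (a ∘ suc) d pos)

-- At x = n+1, absorption rewrites (n+1) C(n,i) as (i+1) C(n+1,i+1), and Pascal's rule lets C(n,i)
-- cancel.
binomial-step : ∀ n i → fromNat (n C i) ℚ.* (recip i ℚ.* fromNat (suc n) ℚ.+ ℚ.- 1ℚ) ≡ fromNat (n C suc i)
binomial-step n i = begin
  c ℚ.* (recip i ℚ.* fromNat (suc n) ℚ.+ ℚ.- 1ℚ)
    ≡⟨ solve 3 (λ c r n → c :* (r :* n :+ :- con 1ℚ) := r :* (n :* c) :+ :- c)
               refl c (recip i) (fromNat (suc n)) ⟩
  recip i ℚ.* (fromNat (suc n) ℚ.* c) ℚ.+ ℚ.- c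
    ≡⟨ cong (λ z → recip i ℚ.* z ℚ.+ ℚ.- c) absorbed ⟩
  recip i ℚ.* (fromNat (suc i) ℚ.* (c ℚ.+ c′)) ℚ.+ ℚ.- c
    ≡⟨ solve 4 (λ r i c c′ → r :* (i :* (c :+ c′)) :+ :- c := r :* i :* (c :+ c′) :+ :- c)
               refl (recip i) (fromNat (suc i)) c c′ ⟩
  recip i ℚ.* fromNat (suc i) ℚ.* (c ℚ.+ c′) ℚ.+ ℚ.- c
    ≡⟨ cong (λ z → z ℚ.* (c ℚ.+ c′) ℚ.+ ℚ.- c) (recip-inverse i) ⟩
  1ℚ ℚ.* (c ℚ.+ c′) ℚ.+ ℚ.- c
    ≡⟨ solve 2 (λ c c′ → con 1ℚ :* (c :+ c′) :+ :- c := c′) refl c c′ ⟩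
  c′ ∎
  where
  open ≡-Reasoning
  open ℚ.+-*-Solver
  c = fromNat (n C i)
  c′ = fromNat (n C suc i)
  absorbed : fromNat (suc n) ℚ.* c ≡ fromNat (suc i) ℚ.* (c ℚ.+ c′)
  absorbed = begin
    fromNat (suc n) ℚ.* c                ≡⟨ fromNat-* (suc n) (n C i) ⟨
    fromNat (suc n * (n C i))            ≡⟨ cong fromNat ([1+n]*nCk≡[1+k]*[1+n]C[1+k] n i) ⟩
    fromNat (suc i * (suc n C suc i))    ≡⟨ fromNat-* (suc i) (suc n C suc i) ⟩
    fromNat (suc i) ℚ.* fromNat (suc n C suc i)
      ≡⟨ cong (λ z → fromNat (suc i) ℚ.* fromNat z) (nCk+nC[k+1]≡[n+1]C[k+1] n i) ⟨
    fromNat (suc i) ℚ.* fromNat (n C i + n C suc i)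
      ≡⟨ cong (fromNat (suc i) ℚ.*_) (fromNat-+ (n C i) (n C suc i)) ⟩
    fromNat (suc i) ℚ.* (c ℚ.+ c′) ∎

-- The polynomial started at `i` represents the binomial sum with C(n,i) factored out. Keeping that
-- factor on the left avoids dividing by a binomial that may be zero; at i = 0 it is 1.
eval-newtonPoly : ∀ i a d n →
  fromNat (n C i) ℚ.* eval (newtonPoly i a d) (fromNat (suc n)) ≡ fromNat (binomialSum i a d n)
eval-newtonPoly i a zero    n = begin
  c ℚ.* (fromNat (a 0) ℚ.+ x ℚ.* 0ℚ)
    ≡⟨ solve 3 (λ c a x → c :* (a :+ x :* con 0ℚ) := a :* c) refl c (fromNat (a 0)) x ⟩
  fromNat (a 0) ℚ.* c ≡⟨ fromNat-* (a 0) (n C i) ⟨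
  fromNat (a 0 * (n C i)) ∎
  where
  open ≡-Reasoning
  open ℚ.+-*-Solver
  c = fromNat (n C i)
  x = fromNat (suc n)
eval-newtonPoly i a (suc d) n = begin
  c ℚ.* eval (newtonPoly i a (suc d)) x
    ≡⟨ cong (c ℚ.*_) (eval-horner (fromNat (a 0)) (recip i) (ℚ.- 1ℚ) (newtonPoly (suc i) (a ∘ suc) d) x) ⟩
  c ℚ.* (fromNat (a 0) ℚ.+ f ℚ.* e)
    ≡⟨ solve 4 (λ c a f e → c :* (a :+ f :* e) := a :* c :+ (c :* f) :* e) refl c (fromNat (a 0)) f e ⟩
  fromNat (a 0) ℚ.* c ℚ.+ c ℚ.* f ℚ.* e
    ≡⟨ cong (λ z → fromNat (a 0) ℚ.* c ℚ.+ z ℚ.* e) (binomial-step n i) ⟩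
  fromNat (a 0) ℚ.* c ℚ.+ fromNat (n C suc i) ℚ.* e
    ≡⟨ cong₂ ℚ._+_ (sym (fromNat-* (a 0) (n C i))) (eval-newtonPoly (suc i) (a ∘ suc) d n) ⟩
  fromNat (a 0 * (n C i)) ℚ.+ fromNat (binomialSum (suc i) (a ∘ suc) d n)
    ≡⟨ fromNat-+ (a 0 * (n C i)) _ ⟨
  fromNat (binomialSum i a (suc d) n) ∎
  where
  open ≡-Reasoning
  open ℚ.+-*-Solver
  c = fromNat (n C i)
  x = fromNat (suc n)
  f = recip i ℚ.* x ℚ.+ ℚ.- 1ℚ
  e = eval (newtonPoly (suc i) (a ∘ suc) d) x

newton-polynomial : ∀ a d → (∀ i → d < i → a i ≡ 0) → ∀ n →
  eval (newtonPoly 0 a d) (fromNat (suc n)) ≡ fromNat (newton a n)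
newton-polynomial a d a≡0 n = begin
  eval p x                        ≡⟨ ℚ.*-identityˡ (eval p x) ⟨
  fromNat (n C 0) ℚ.* eval p x    ≡⟨ eval-newtonPoly 0 a d n ⟩
  fromNat (binomialSum 0 a d n)   ≡⟨ cong fromNat (newton-binomialSum a d a≡0 n) ⟨
  fromNat (newton a n) ∎
  where
  open ≡-Reasoning
  p = newtonPoly 0 a d
  x = fromNat (suc n)

-- Differences of order above d vanish at k because 2k is at most 2+d+e. At order d a positive
-- joined part suffices, since the split part is a natural number and cannot cancel it.
count-polynomial : ∀ q k d {e} → k * 2 ≤ 2 + (d + e) → Vanishing e (count q 0) →
  0 < growths d (count q 0) true k →
  ∃[ D ] HasDegree D d × (∀ m → eval D (fromNat (suc m)) ≡ fromNat (∑ᵇ λ v → count q m v k))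
count-polynomial q k d {e} k≤ v0 pos = newtonPoly 0 a d ,
  newtonPoly-degree 0 a d (≤-trans pos (m≤m+n (b true d) _)) , λ m →
  trans (newton-polynomial a d a≡0 m) (cong fromNat (trans (newton-+ (b true) (b false) m)
    (sym (cong₂ _+_ (newton-growths (count q) (count-suc q) m true k)
                    (newton-growths (count q) (count-suc q) m false k)))))
  where
  b : Bool → ℕ → ℕ
  b v i = growths i (count q 0) v k
  a : ℕ → ℕ
  a i = b true i + b false i
  a≡0 : ∀ i → d < i → a i ≡ 0
  a≡0 i d<i with growths-vanishing i {f = count q 0} v0
  ... | t0 , f0 = cong₂ _+_ (t0 k k≤′) (f0 k (≤-trans k≤′ (n≤1+n _)))
    where
    k≤′ : k * 2 ≤ 1 + (i + e)
    k≤′ = ≤-trans k≤ (s≤s (+-monoˡ-≤ e d<i))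

-- A single column has one joined pattern, with one piece, and one split pattern, with two.
count-vanishing : Vanishing 0 (count (const true) 0)
count-vanishing = (λ { zero _ → refl ; (suc _) (s≤s ()) })
                , (λ { zero _ → refl ; (suc zero) _ → refl ; (suc (suc _)) (s≤s (s≤s ())) })

-- Requiring a split rightmost column removes the joined pattern, so vanishing starts one level
-- higher; this lowers the degree by one.
count-not-vanishing : Vanishing 1 (count not 0)
count-not-vanishing = (λ _ _ → refl)
                    , (λ { zero _ → refl ; (suc zero) _ → refl ; (suc (suc _)) (s≤s (s≤s (s≤s ()))) })

theorem3 :
    (∀ k → 1 ≤ k →
      ∃[ D ] HasDegree D (2 * k ∸ 2) ×
        (∀ n → .{{_ : NonZero n}} →
          ∃[ m ] (d[ k , n ]≔ m) × eval D (fromNat n) ≡ fromNat m))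
    ×
    (∀ k → 2 ≤ k →
      ∃[ S ] HasDegree S (2 * k ∸ 3) ×
        (∀ n → .{{_ : NonZero n}} →
          ∃[ m ] (s[ k , n ]≔ m) × eval S (fromNat n) ≡ fromNat m))
theorem3 = divisionsPolynomial , splitDivisionsPolynomial
  where
  divisionsPolynomial : ∀ k → 1 ≤ k → ∃[ D ] HasDegree D (2 * k ∸ 2) ×
    (∀ n → .{{_ : NonZero n}} → ∃[ m ] (d[ k , n ]≔ m) × eval D (fromNat n) ≡ fromNat m)
  divisionsPolynomial k@(suc j) _ = attach (count-polynomial (const true) k (j * 2) {0}
      (≤-reflexive (cong (2 +_) (sym (+-identityʳ (j * 2))))) count-vanishing pos)
    where
    pos : 0 < growths (j * 2) (count (const true) 0) true k
    pos = subst (λ k → 0 < growths (j * 2) (count (const true) 0) true k) (+-comm j 1)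
            -- Start at the joined single column with one piece; j double steps lead to k = j+1.
            (growths-pos j (count (const true) 0) {1} z<s)

    attach : (∃[ D ] HasDegree D (j * 2) ×
               (∀ m → eval D (fromNat (suc m)) ≡ fromNat (∑ᵇ λ v → count (const true) m v k))) →
             ∃[ D ] HasDegree D (2 * k ∸ 2) ×
               (∀ n → .{{_ : NonZero n}} → ∃[ m ] (d[ k , n ]≔ m) × eval D (fromNat n) ≡ fromNat m)
    attach (D , degree , values) = D , subst (HasDegree D) (cong (_∸ 2) (*-comm k 2)) degree , λ
      { (suc m) → (∑ᵇ λ v → count (const true) m v k) , divisions-cardinality k m , values m }

  splitDivisionsPolynomial : ∀ k → 2 ≤ k → ∃[ S ] HasDegree S (2 * k ∸ 3) ×
    (∀ n → .{{_ : NonZero n}} → ∃[ m ] (s[ k , n ]≔ m) × eval S (fromNat n) ≡ fromNat m)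
  splitDivisionsPolynomial (suc zero)      (s≤s ())
  splitDivisionsPolynomial k@(suc (suc j)) _ = attach (count-polynomial not k (suc (j * 2)) {1}
      (≤-reflexive (cong (3 +_) (+-comm 1 (j * 2)))) count-not-vanishing pos)
    where
    pos : 0 < growths (suc (j * 2)) (count not 0) true k
    pos = subst (λ k → 0 < growths (suc (j * 2)) (count not 0) true k) (+-comm j 2)
            -- One `growth` first takes the split single column with two pieces to a joined one; j
            -- double steps then lead to k = j+2.
            (growths-pos j (growth (count not 0)) {2} z<s)

    attach : (∃[ S ] HasDegree S (suc (j * 2)) ×
               (∀ m → eval S (fromNat (suc m)) ≡ fromNat (∑ᵇ λ v → count not m v k))) →
             ∃[ S ] HasDegree S (2 * k ∸ 3) ×
               (∀ n → .{{_ : NonZero n}} → ∃[ m ] (s[ k , n ]≔ m) × eval S (fromNat n) ≡ fromNat m)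
    attach (S , degree , values) = S , subst (HasDegree S) (cong (_∸ 3) (*-comm k 2)) degree , λ
      { (suc m) → (∑ᵇ λ v → count not m v k) , splitDivisions-cardinality k m , values m }
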